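{- Let $k\geq 1$ and let $G_1,\ldots,G_k$ be pairwise vertex-disjoint connected graphs, none of which is isomorphic to a path. For each $i=1,\ldots,k$ let $g_i\in V(G_i)$ be a vertex that belongs to some metric basis of $G_i$. Let $W$ be the graph with $V(W)=\bigcup_{i=1}^k V(G_i)$ and $E(W)=\{\{g_i,g_j\}: i\neq j\}\cup\bigcup_{i=1}^k E(G_i)$. Then a set $R\subseteq V(W)$ is a metric basis of $W$ if and only if $R=\bigcup_{i=1}^k \left(R_i\setminus\{g_i\}\right)$, where for each $i$, $R_i$ is a metric basis of $G_i$ containing $g_i$. Consequently, $\dim(W)=\sum_{i=1}^k \dim(G_i)-k$.
   Context: All graphs are finite and simple. For vertices $u,v$ of a connected graph $G$, $d(u,v)$ is the length of a shortest $u$–$v$ path in $G$. A set $R\subseteq V(G)$ is a resolving set if for all distinct $x,y\in V(G)$ there is $r\in R$ with $d(r,x)\neq d(r,y)$. The metric dimension $\dim(G)$ is the minimum cardinality of a resolving set, and a resolving set of cardinality $\dim(G)$ is a metric basis.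
   Formalization: The formal statement assumes k ≥ 2 instead of k ≥ 1: for k = 1 no edges are added, so W = G_1, and the claim would give dim(G_1) = dim(G_1) − 1, which is always false. -}

module Defs where

open import Data.Nat using (ℕ; zero; suc; _+_; _≤_; z≤n; s≤s)
import Data.Nat.Properties as ℕ
open import Data.Fin using (Fin; zero; suc; toℕ)
import Data.Fin.Properties as Fin
open import Data.Fin.Subset using (Subset; ∣_∣; ⊤) renaming (_∈_ to _∈ꜰ_)
open import Data.Fin.Subset.Properties using (anySubset?; ∈⊤) renaming (_∈?_ to _∈ꜰ?_)
open import Data.List using (List; []; _∷_; _++_; map)
open import Data.List.Membership.Propositional using () renaming (_∈_ to _∈ˡ_)
open import Data.List.Membership.Propositional.Properties using (∈-map⁻)
open import Data.List.Relation.Unary.All using ([])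
open import Data.List.Relation.Unary.AllPairs using ([]; _∷_)
open import Data.List.Relation.Unary.Unique.Propositional using (Unique)
import Data.List.Relation.Unary.Unique.Propositional.Properties as Unique
import Data.List.Relation.Unary.Unique.DecPropositional as DecUnique
open import Data.Product using (Σ; ∃; _×_; _,_; proj₁; proj₂)
open import Data.Sum using (_⊎_; inj₁; inj₂; swap)
open import Data.Sum.Function.Propositional using (_⊎-↔_)
import Data.Vec as Vec
open import Function using (_∘_; _↔_; _⇔_; Inverse; mk↔ₛ′)
open import Function.Properties.Inverse using (↔⇒↣; ↔-sym; ↔-trans; ↔-refl)
open import Relation.Binary.Definitions using (Decidable; DecidableEquality; Symmetric)
open import Relation.Binary.PropositionalEquality using (_≡_; _≢_; refl; sym; trans; cong; subst)
open import Relation.Nullary using (¬_; Dec; yes; no; contradiction)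
open import Relation.Nullary.Decidable using (map′; via-injection; ¬?; _×-dec_; _⊎-dec_; _→-dec_)
import Relation.Unary as U

record IsMinimum (P : ℕ → Set) (m : ℕ) : Set where
  field
    attained : P m
    minimal  : ∀ l → P l → m ≤ l

minimum : {P : ℕ → Set} → U.Decidable P → ∀ n → P n → ∃ (IsMinimum P)
minimum P? zero p = 0 , record { attained = p ; minimal = λ _ _ → z≤n }
minimum {P} P? (suc n) p with P? 0
... | yes p₀ = 0 , record { attained = p₀ ; minimal = λ _ _ → z≤n }
... | no ¬p₀ with minimum (P? ∘ suc) n p
... | m , min = suc m , record { attained = attained ; minimal = minimal′ }
  where
  open IsMinimum min
  minimal′ : ∀ l → P l → suc m ≤ l
  minimal′ zero    q = contradiction q ¬p₀
  minimal′ (suc l) q = s≤s (minimal l q)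

-- Finite simple graphs.  Finiteness is an explicit enumeration of the vertices;
-- adjacency is decidable, as it is classically for every finite graph.
record Graph : Set₁ where
  infix 4 _~_ _~?_
  field
    Vertex   : Set
    order    : ℕ
    index    : Vertex ↔ Fin order
    _~_      : Vertex → Vertex → Set
    _~?_     : Decidable _~_
    ~-sym    : Symmetric _~_
    ~-irrefl : ∀ {v} → ¬ (v ~ v)

  _≟_ : DecidableEquality Vertex
  _≟_ = via-injection (↔⇒↣ index) Fin._≟_

  anyVertex? : {P : Vertex → Set} → U.Decidable P → Dec (∃ P)
  anyVertex? {P} P? = map′
    (λ (i , p) → from i , p)
    (λ (v , p) → to v , subst P (sym (strictlyInverseʳ v)) p)
    (Fin.any? (P? ∘ from))
    where open Inverse index

  allVertices? : {P : Vertex → Set} → U.Decidable P → Dec (∀ v → P v)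
  allVertices? {P} P? = map′
    (λ h v → subst P (strictlyInverseʳ v) (h (to v)))
    (λ h i → h (from i))
    (Fin.all? (P? ∘ from))
    where open Inverse index

  data Walk : Vertex → Vertex → ℕ → Set where
    []  : ∀ {v} → Walk v v 0
    _∷_ : ∀ {u v w ℓ} → u ~ v → Walk v w ℓ → Walk u w (suc ℓ)

  vertices : ∀ {u v ℓ} → Walk u v ℓ → List Vertex
  vertices {u} []      = u ∷ []
  vertices {u} (_ ∷ p) = u ∷ vertices p

  -- Path u v ℓ : paths from u to v with ℓ edges, i.e. walks repeating no vertex.
  Path : Vertex → Vertex → ℕ → Set
  Path u v ℓ = Σ (Walk u v ℓ) (Unique ∘ vertices)

  anyWalk? : {P : List Vertex → Set} → U.Decidable P →
             ∀ u v ℓ → Dec (Σ (Walk u v ℓ) (P ∘ vertices))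
  anyWalk? {P} P? u v zero = map′
    (λ { (refl , p) → [] , p }) (λ { ([] , p) → refl , p })
    ((u ≟ v) ×-dec P? (u ∷ []))
  anyWalk? P? u v (suc ℓ) = map′
    (λ (_ , e , w , p) → (e ∷ w) , p) (λ { ((e ∷ w) , p) → _ , e , w , p })
    (anyVertex? λ x → (u ~? x) ×-dec anyWalk? (P? ∘ (u ∷_)) x v ℓ)

  path? : ∀ u v → U.Decidable (Path u v)
  path? = anyWalk? (DecUnique.unique? _≟_)

  Connected : Set
  Connected = ∀ u v → ∃ (Path u v)

  -- Sets of vertices are subsets of the indices.
  VertexSet : Set
  VertexSet = Subset order

  infix 4 _∈_ _∈?_
  _∈_ : Vertex → VertexSet → Set
  v ∈ R = Inverse.to index v ∈ꜰ R

  _∈?_ : ∀ v R → Dec (v ∈ R)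
  v ∈? R = Inverse.to index v ∈ꜰ? R

record ConnectedGraph : Set₁ where
  field
    graph     : Graph
  open Graph graph public
  field
    connected : Connected

  shortestPath : ∀ u v → ∃ (IsMinimum (Path u v))
  shortestPath u v = let ℓ , p = connected u v in minimum (path? u v) ℓ p

  d : Vertex → Vertex → ℕ
  d u v = proj₁ (shortestPath u v)

  Resolving : VertexSet → Set
  Resolving R = ∀ x y → x ≢ y → ∃ λ r → r ∈ R × d r x ≢ d r y

  resolving? : U.Decidable Resolving
  resolving? R = allVertices? λ x → allVertices? λ y → ¬? (x ≟ y) →-dec
    anyVertex? λ r → (r ∈? R) ×-dec ¬? (d r x ℕ.≟ d r y)

  d-self : ∀ v → d v v ≡ 0
  d-self v = ℕ.n≤0⇒n≡0
    (IsMinimum.minimal (proj₂ (shortestPath v v)) 0 ([] , [] ∷ []))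

  d≡0⇒≡ : ∀ u v → d u v ≡ 0 → u ≡ v
  d≡0⇒≡ u v eq with d u v | IsMinimum.attained (proj₂ (shortestPath u v))
  d≡0⇒≡ u v refl | _ | [] , _ = refl

  ⊤-resolving : Resolving ⊤
  ⊤-resolving x y x≢y =
    x , ∈⊤ , λ eq → x≢y (d≡0⇒≡ x y (trans (sym eq) (d-self x)))

  ResolvingOfSize : ℕ → Set
  ResolvingOfSize m = ∃ λ R → Resolving R × ∣ R ∣ ≡ m

  minimumResolving : ∃ (IsMinimum ResolvingOfSize)
  minimumResolving = minimum
    (λ m → anySubset? λ R → resolving? R ×-dec (∣ R ∣ ℕ.≟ m))
    ∣ ⊤ {order} ∣ (⊤ , ⊤-resolving , refl)

  dim : ℕ
  dim = proj₁ minimumResolving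

  MetricBasis : VertexSet → Set
  MetricBasis R = Resolving R × ∣ R ∣ ≡ dim

record _≅_ (G H : Graph) : Set where
  private
    module G = Graph G
    module H = Graph H
  field
    bijection : G.Vertex ↔ H.Vertex
  open Inverse bijection using (to)
  field
    preserves : ∀ u v → (u G.~ v) ⇔ (to u H.~ to v)

pathGraph : ℕ → Graph
pathGraph n = record
  { Vertex   = Fin n
  ; order    = n
  ; index    = ↔-refl
  ; _~_      = λ i j → suc (toℕ i) ≡ toℕ j ⊎ suc (toℕ j) ≡ toℕ i
  ; _~?_     = λ i j → (suc (toℕ i) ℕ.≟ toℕ j) ⊎-dec (suc (toℕ j) ℕ.≟ toℕ i)
  ; ~-sym    = swap
  ; ~-irrefl = λ { (inj₁ eq) → ℕ.1+n≢n eq ; (inj₂ eq) → ℕ.1+n≢n eq }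
  }

IsPathGraph : Graph → Set
IsPathGraph G = ∃ λ n → G ≅ pathGraph n

sumFin : ∀ {k} → (Fin k → ℕ) → ℕ
sumFin f = Vec.sum (Vec.tabulate f)

private
  Σ-suc : ∀ {k} (A : Fin (suc k) → Set) → Σ (Fin (suc k)) A ↔ (A zero ⊎ Σ (Fin k) (A ∘ suc))
  Σ-suc A = mk↔ₛ′
    (λ { (zero , a) → inj₁ a ; (suc i , a) → inj₂ (i , a) })
    (λ { (inj₁ a) → zero , a ; (inj₂ (i , a)) → suc i , a })
    (λ { (inj₁ _) → refl ; (inj₂ _) → refl })
    (λ { (zero , _) → refl ; (suc _ , _) → refl })

Σ↔Fin : ∀ {k} {A : Fin k → Set} {n : Fin k → ℕ} →
        (∀ i → A i ↔ Fin (n i)) → Σ (Fin k) A ↔ Fin (sumFin n)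
Σ↔Fin {zero}  _ = mk↔ₛ′ (λ ()) (λ ()) (λ ()) (λ ())
Σ↔Fin {suc k} {A} f = ↔-trans (Σ-suc A)
  (↔-trans (f zero ⊎-↔ Σ↔Fin (f ∘ suc)) (↔-sym Fin.+↔⊎))

-- The graphs G i together with a clique on the vertices g i.  The disjoint union
-- of the vertex sets is the dependent sum, so pairwise disjointness is automatic.
module Join {k : ℕ} (G : Fin k → ConnectedGraph)
            (g : ∀ i → ConnectedGraph.Vertex (G i)) where
  private module G (i : Fin k) = ConnectedGraph (G i)

  JoinVertex : Set
  JoinVertex = Σ (Fin k) G.Vertex

  data JoinAdj : JoinVertex → JoinVertex → Set where
    within  : ∀ {i x y} → G._~_ i x y → JoinAdj (i , x) (i , y)
    between : ∀ {i j} → i ≢ j → JoinAdj (i , g i) (j , g j)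

  joinAdj? : Decidable JoinAdj
  joinAdj? (i , x) (j , y) with i Fin.≟ j
  ... | yes refl = map′ within
    (λ { (within e) → e ; (between i≢i) → contradiction refl i≢i })
    (G._~?_ i x y)
  ... | no i≢j = map′
    (λ { (refl , refl) → between i≢j })
    (λ { (within _) → contradiction refl i≢j ; (between _) → refl , refl })
    (G._≟_ i x (g i) ×-dec G._≟_ j y (g j))

  joinGraph : Graph
  joinGraph = record
    { Vertex   = JoinVertex
    ; order    = sumFin G.order
    ; index    = Σ↔Fin G.index
    ; _~_      = JoinAdj
    ; _~?_     = joinAdj?
    ; ~-sym    = λ { (within e) → within (G.~-sym _ e) ; (between i≢j) → between (i≢j ∘ sym) }
    ; ~-irrefl = λ { (within e) → G.~-irrefl _ e ; (between i≢i) → i≢i refl }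
    }

  private module W = Graph joinGraph

  lift : ∀ {i x y ℓ} → G.Walk i x y ℓ → W.Walk (i , x) (i , y) ℓ
  lift G.[]      = W.[]
  lift (e G.∷ p) = within e W.∷ lift p

  vertices-lift : ∀ {i x y ℓ} (p : G.Walk i x y ℓ) →
                  W.vertices (lift p) ≡ map (i ,_) (G.vertices i p)
  vertices-lift G.[]      = refl
  vertices-lift (e G.∷ p) = cong (_ ∷_) (vertices-lift p)

  lift-unique : ∀ {i x y ℓ} (p : G.Walk i x y ℓ) →
                Unique (G.vertices i p) → Unique (W.vertices (lift p))
  lift-unique {i} p u = subst Unique (sym (vertices-lift p))
    (Unique.map⁺ (λ { refl → refl }) u)

  join : ∀ {u v w z ℓ m} → W.Walk u v ℓ → v W.~ w → W.Walk w z m →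
         W.Walk u z (ℓ + suc m)
  join W.[]      e q = e W.∷ q
  join (f W.∷ p) e q = f W.∷ join p e q

  vertices-join : ∀ {u v w z ℓ m} (p : W.Walk u v ℓ) (e : v W.~ w) (q : W.Walk w z m) →
                  W.vertices (join p e q) ≡ W.vertices p ++ W.vertices q
  vertices-join W.[]      e q = refl
  vertices-join (f W.∷ p) e q = cong (_ ∷_) (vertices-join p e q)

  joinConnected : W.Connected
  joinConnected (i , x) (j , y) with i Fin.≟ j
  ... | yes refl with G.connected i x y
  ...   | _ , p , u = _ , lift p , lift-unique p u
  joinConnected (i , x) (j , y) | no i≢j
    with G.connected i x (g i) | G.connected j (g j) y
  ...   | _ , p , u | _ , q , v = _ , join (lift p) (between i≢j) (lift q) ,
    subst Unique (sym (vertices-join (lift p) (between i≢j) (lift q)))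
      (Unique.++⁺ (lift-unique p u) (lift-unique q v) disjoint)
    where
    disjoint : ∀ {v} → ¬ (v ∈ˡ W.vertices (lift p) × v ∈ˡ W.vertices (lift q))
    disjoint {v} (v∈p , v∈q)
      with ∈-map⁻ (i ,_) (subst (v ∈ˡ_) (vertices-lift p) v∈p)
         | ∈-map⁻ (j ,_) (subst (v ∈ˡ_) (vertices-lift q) v∈q)
    ... | _ , _ , refl | _ , _ , refl = i≢j refl

  joinAt : ConnectedGraph
  joinAt = record { graph = joinGraph ; connected = joinConnected }

open Join public using (joinAt)

{-# OPTIONS --safe #-}

-- A walk between different parts of W passes through both clique vertices, so
-- d((i,x),(j,y)) = d(x,g i) + 1 + d(g j,y), while distances inside a part are
-- unchanged.  From the point of view of the part i, a landmark in another part
-- therefore acts exactly like g i.  Hence adding g i to the trace on the part i of a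
-- resolving set of W gives a resolving set of G i.  Conversely, resolving sets
-- of the G i stay jointly resolving after the deletion of the g i, as soon as each
-- part keeps a landmark: a landmark of another part replaces g i, and vertices
-- (i,x), (j,y) that the landmarks of the parts i and j both fail to separate
-- would satisfy d(g i,x) > d(g j,y) > d(g i,x).  A part keeps no landmark only
-- if g i alone resolves G i, and then G i is a path.  Counting finishes the proof.

module Submission where

open import Defs
open import Data.Nat using (ℕ; zero; suc; _+_; _∸_; _≤_; _<_; z≤n; s≤s; s≤s⁻¹)
import Data.Nat.Properties as ℕ
open import Data.Integer using (+_; _-_; _⊖_)
import Data.Integer.Properties as ℤ
open import Data.Fin using (Fin; zero; suc; toℕ; fromℕ<)
import Data.Fin.Properties as Fin
open import Data.Fin.Subset using (Subset; ∣_∣; inside; outside) renaming (_∈_ to _∈ꜰ_; _∉_ to _∉ꜰ_)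
open import Data.Fin.Subset.Properties using (⊆-antisym)
open import Data.List.Membership.Propositional using () renaming (_∈_ to _∈ˡ_)
import Data.List.Membership.DecPropositional as DecMembership
open import Data.List.Relation.Unary.All using ([])
open import Data.List.Relation.Unary.All.Properties using (¬Any⇒All¬)
open import Data.List.Relation.Unary.AllPairs using ([]; _∷_)
open import Data.List.Relation.Unary.Any using (here; there)
open import Data.List.Relation.Unary.Unique.Propositional using (Unique)
open import Data.Product using (∃; _×_; _,_; proj₁; proj₂)
open import Data.Sum using (inj₁; inj₂)
open import Data.Vec using ([]; _∷_; _++_; lookup; tabulate; splitAt; _[_]≔_; here; there)
open import Data.Vec.Properties using (lookup-++ˡ; lookup-++ʳ; lookup∘tabulate; tabulate∘lookup; tabulate-cong; []=⇒lookup; lookup⇒[]=; []≔-lookup; []≔-updates; []≔-minimal; lookup∘update′)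
open import Function using (_⇔_; _↔_; _∘_; Inverse; Injection; Equivalence; mk⇔; mk↔ₛ′)
open import Function.Properties.Inverse using (↔⇒↣)
open import Relation.Binary.PropositionalEquality using (_≡_; _≢_; refl; sym; trans; cong; cong₂; subst; module ≡-Reasoning)
open import Relation.Nullary using (¬_; Dec; yes; no; does; contradiction)
open import Relation.Nullary.Decidable using (¬?; _×-dec_; decidable-stable; dec-true)
open import Relation.Binary.Definitions using (tri<; tri≈; tri>)
import Relation.Unary as U
open import Relation.Unary using (_≐_)
open ConnectedGraph using (graph; Vertex; VertexSet; _∈_; MetricBasis; dim)

-- Finite sums and bounds.

sumFin-mono : ∀ {k} {a b : Fin k → ℕ} → (∀ i → a i ≤ b i) → sumFin a ≤ sumFin b
sumFin-mono {zero}  a≤b = z≤n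
sumFin-mono {suc k} a≤b = ℕ.+-mono-≤ (a≤b zero) (sumFin-mono (a≤b ∘ suc))

sumFin-cong : ∀ {k} {a b : Fin k → ℕ} → (∀ i → a i ≡ b i) → sumFin a ≡ sumFin b
sumFin-cong {zero}  a≡b = refl
sumFin-cong {suc k} a≡b = cong₂ _+_ (a≡b zero) (sumFin-cong (a≡b ∘ suc))

sumFin-suc : ∀ {k} (a : Fin k → ℕ) → sumFin (suc ∘ a) ≡ sumFin a + k
sumFin-suc {zero}  a = refl
sumFin-suc {suc k} a = begin
  suc (a zero) + sumFin (suc ∘ a ∘ suc)    ≡⟨ cong (λ s → suc (a zero + s)) (sumFin-suc (a ∘ suc)) ⟩
  suc (a zero + (sumFin (a ∘ suc) + k))    ≡⟨ cong suc (ℕ.+-assoc (a zero) _ k) ⟨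
  suc (sumFin a + k)                       ≡⟨ ℕ.+-suc (sumFin a) k ⟨
  sumFin a + suc k                         ∎
  where open ≡-Reasoning

-- A deficit in one term cannot be made up by the others, none of which exceeds its counterpart.
-- This turns equality of total sizes into equality in every part.
sumFin-tight : ∀ {k} {a b : Fin k → ℕ} → (∀ i → a i ≤ b i) →
               sumFin b ≤ sumFin a → ∀ i → b i ≤ a i
sumFin-tight {suc k} {a} {b} a≤b Σb≤Σa zero =
  ℕ.+-cancelʳ-≤ (sumFin (a ∘ suc)) (b zero) (a zero)
    (ℕ.≤-trans (ℕ.+-monoʳ-≤ (b zero) (sumFin-mono (a≤b ∘ suc))) Σb≤Σa)
sumFin-tight {suc k} {a} {b} a≤b Σb≤Σa (suc i) = sumFin-tight (a≤b ∘ suc)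
  (ℕ.+-cancelˡ-≤ (a zero) _ _ (ℕ.≤-trans (ℕ.+-monoˡ-≤ _ (a≤b zero)) Σb≤Σa)) i

-- Provides a value that no distance from a fixed vertex attains; the search for the least such
-- value is bounded by it.
strictBound : ∀ {n} (f : Fin n → ℕ) → ∃ λ b → ∀ i → f i < b
strictBound {zero}  f = 0 , λ ()
strictBound {suc n} f with strictBound (f ∘ suc)
... | b , f<b = suc (f zero) + b , λ
  { zero    → ℕ.m≤m+n _ b
  ; (suc i) → ℕ.≤-trans (f<b i) (ℕ.m≤n+m b _) }

other : ∀ {k} → 2 ≤ k → (i : Fin k) → ∃ λ j → i ≢ j
other (s≤s (s≤s _)) zero    = suc zero , λ ()
other (s≤s (s≤s _)) (suc i) = zero , λ ()

-- Insertion into finite subsets, and cardinality.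

module _ {n : ℕ} where

  insert : Fin n → Subset n → Subset n
  insert x p = p [ x ]≔ inside

  ∈-insert : ∀ x (p : Subset n) → x ∈ꜰ insert x p
  ∈-insert x p = []≔-updates p x

  insert-∈ : ∀ {x} {p : Subset n} → x ∈ꜰ p → insert x p ≡ p
  insert-∈ {x} {p} x∈p =
    trans (cong (p [ x ]≔_) (sym ([]=⇒lookup x∈p))) ([]≔-lookup p x)

  ∈-insert⁺ : ∀ x {y} {p : Subset n} → y ∈ꜰ p → y ∈ꜰ insert x p
  ∈-insert⁺ x {y} {p} y∈p with y Fin.≟ x
  ... | yes refl = ∈-insert x p
  ... | no y≢x   = []≔-minimal p y x y≢x y∈p

  ∈-insert⁻ : ∀ {x y} {p : Subset n} → y ≢ x → y ∈ꜰ insert x p → y ∈ꜰ p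
  ∈-insert⁻ {x} {y} {p} y≢x y∈ =
    lookup⇒[]= y p (trans (sym (lookup∘update′ y≢x p inside)) ([]=⇒lookup y∈))

∣insert∣-∉ : ∀ {n x} {p : Subset n} → x ∉ꜰ p → ∣ insert x p ∣ ≡ suc ∣ p ∣
∣insert∣-∉ {x = zero}  {inside  ∷ p} x∉ = contradiction here x∉
∣insert∣-∉ {x = zero}  {outside ∷ p} x∉ = refl
∣insert∣-∉ {x = suc x} {inside  ∷ p} x∉ = cong suc (∣insert∣-∉ (x∉ ∘ there))
∣insert∣-∉ {x = suc x} {outside ∷ p} x∉ = ∣insert∣-∉ (x∉ ∘ there)

∣insert∣≤ : ∀ {n} x (p : Subset n) → ∣ insert x p ∣ ≤ suc ∣ p ∣
∣insert∣≤ zero    (inside  ∷ p) = ℕ.n≤1+n _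
∣insert∣≤ zero    (outside ∷ p) = ℕ.≤-refl
∣insert∣≤ (suc x) (inside  ∷ p) = s≤s (∣insert∣≤ x p)
∣insert∣≤ (suc x) (outside ∷ p) = ∣insert∣≤ x p

∣++∣ : ∀ {m n} (p : Subset m) (q : Subset n) → ∣ p ++ q ∣ ≡ ∣ p ∣ + ∣ q ∣
∣++∣ []            q = refl
∣++∣ (inside  ∷ p) q = cong suc (∣++∣ p q)
∣++∣ (outside ∷ p) q = ∣++∣ p q

-- Restriction of a subset of a disjoint union to its parts.

module _ {k} {A : Fin k → Set} {n : Fin k → ℕ} (f : ∀ i → A i ↔ Fin (n i)) where

  -- Indexed by the numbering of `A i` itself, so that it can be compared with vertex sets of the
  -- single part.
  fibre : Subset (sumFin n) → ∀ i → Subset (n i)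
  fibre p i = tabulate λ j → lookup p (Inverse.to (Σ↔Fin f) (i , Inverse.from (f i) j))

-- `Σ↔Fin` numbers the parts one after another, so `p` is the concatenation of a block `q` for the
-- first part and a block `r` for the rest.
∣fibre∣ : ∀ {k} {A : Fin k → Set} {n : Fin k → ℕ} (f : ∀ i → A i ↔ Fin (n i)) p →
          ∣ p ∣ ≡ sumFin λ i → ∣ fibre f p i ∣
∣fibre∣ {zero}  f [] = refl
∣fibre∣ {suc k} {n = n} f p with splitAt (n zero) p
... | q , r , refl = trans (∣++∣ q r) (cong₂ _+_ (cong ∣_∣ (sym head)) (trans (∣fibre∣ (f ∘ suc) r) tail))
  where
  head : fibre f (q ++ r) zero ≡ q
  head = trans
    (tabulate-cong λ j → trans (lookup-++ˡ q r _)
      (cong (lookup q) (Inverse.strictlyInverseˡ (f zero) j)))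
    (tabulate∘lookup q)
  tail : sumFin (λ i → ∣ fibre (f ∘ suc) r i ∣) ≡ sumFin (λ i → ∣ fibre f (q ++ r) (suc i) ∣)
  tail = sumFin-cong λ i → cong ∣_∣ (tabulate-cong λ j → sym (lookup-++ʳ q r
      (Inverse.to (Σ↔Fin (f ∘ suc)) (i , Inverse.from (f (suc i)) j))))

-- Vertex sets from predicates; walks and paths.

module _ (G : Graph) where
  open Graph G renaming (_∈_ to _∈ᵍ_)

  comprehension : {P : Graph.Vertex G → Set} → U.Decidable P → ∃ λ R → ∀ v → v ∈ᵍ R ⇔ P v
  comprehension {P} P? = R , λ v → mk⇔ (∈⇒P v) (P⇒∈ v)
    where
    open Inverse index
    R : Graph.VertexSet G
    R = tabulate λ j → does (P? (from j))
    lookup-R : ∀ v → lookup R (to v) ≡ does (P? v)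
    lookup-R v = trans (lookup∘tabulate _ (to v)) (cong (does ∘ P?) (strictlyInverseʳ v))
    ∈⇒P : ∀ v → v ∈ᵍ R → P v
    ∈⇒P v v∈R with P? v | trans (sym (lookup-R v)) ([]=⇒lookup v∈R)
    ... | yes p | _ = p
    P⇒∈ : ∀ v → P v → v ∈ᵍ R
    P⇒∈ v p = lookup⇒[]= (to v) R (trans (lookup-R v) (dec-true (P? v) p))

  dropUntil : ∀ {u v w ℓ} (p : Walk v w ℓ) → Unique (vertices p) → u ∈ˡ vertices p →
              ∃ λ m → m ≤ ℓ × Path u w m
  dropUntil []      uniq       (here refl) = _ , ℕ.≤-refl , [] , uniq
  dropUntil (e ∷ p) uniq       (here refl) = _ , ℕ.≤-refl , (e ∷ p) , uniq
  dropUntil (e ∷ p) (_ ∷ uniq) (there u∈p) with dropUntil p uniq u∈p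
  ... | m , m≤ℓ , q = m , ℕ.m≤n⇒m≤1+n m≤ℓ , q

  -- Distance is defined through paths, but only walks can be concatenated freely. If `u` recurs on
  -- the path built so far, everything before that occurrence is cut off.
  eraseLoops : ∀ {u v ℓ} → Walk u v ℓ → ∃ λ m → m ≤ ℓ × Path u v m
  eraseLoops []          = 0 , z≤n , [] , [] ∷ []
  eraseLoops {u} (e ∷ p) with eraseLoops p
  ... | m , m≤ℓ , q , uniq with DecMembership._∈?_ _≟_ u (vertices q)
  ...   | no u∉q = suc m , s≤s m≤ℓ , (e ∷ q) , ¬Any⇒All¬ _ u∉q ∷ uniq
  ...   | yes u∈q with dropUntil q uniq u∈q
  ...     | l , l≤m , r = l , ℕ.≤-trans l≤m (ℕ.m≤n⇒m≤1+n m≤ℓ) , r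

  concatWalk : ∀ {u v w ℓ m} → Walk u v ℓ → Walk v w m → Walk u w (ℓ + m)
  concatWalk []      q = q
  concatWalk (e ∷ p) q = e ∷ concatWalk p q

  unsnocWalk : ∀ {u v ℓ} → Walk u v (suc ℓ) → ∃ λ w → Walk u w ℓ × w ~ v
  unsnocWalk (e ∷ [])        = _ , [] , e
  unsnocWalk (e ∷ p@(_ ∷ _)) with unsnocWalk p
  ... | w , q , e′ = w , (e ∷ q) , e′

-- Distances and resolving sets in a connected graph.

module Distance (G : ConnectedGraph) where
  open ConnectedGraph G hiding (Vertex; VertexSet; _∈_; dim; graph; MetricBasis)

  d-walk : ∀ u v → Walk u v (d u v)
  d-walk u v = proj₁ (IsMinimum.attained (proj₂ (shortestPath u v)))

  d-minimal : ∀ {u v ℓ} → Walk u v ℓ → d u v ≤ ℓ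
  d-minimal {u} {v} p with eraseLoops (graph G) p
  ... | m , m≤ℓ , q = ℕ.≤-trans (IsMinimum.minimal (proj₂ (shortestPath u v)) m q) m≤ℓ

  d-triangle : ∀ u v w → d u w ≤ d u v + d v w
  d-triangle u v w = d-minimal (concatWalk (graph G) (d-walk u v) (d-walk v w))

  d-consˡ : ∀ {u v} w → u ~ v → d u w ≤ suc (d v w)
  d-consˡ {v = v} w e = d-minimal (e ∷ d-walk v w)

  d-snocʳ : ∀ u {v w} → v ~ w → d u w ≤ suc (d u v)
  d-snocʳ u {v} {w} e = subst (d u w ≤_) (ℕ.+-comm (d u v) 1)
    (d-minimal (concatWalk (graph G) (d-walk u v) (e ∷ [])))

  d-predecessor : ∀ u v {m} → d u v ≡ suc m → ∃ λ w → d u w ≡ m × w ~ v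
  d-predecessor u v {m} eq with unsnocWalk (graph G) (subst (Walk u v) eq (d-walk u v))
  -- `w` is the last vertex but one of a shortest walk: `p` bounds its distance from above, and the
  -- edge to `v` bounds it from below.
  ... | w , p , e = w , ℕ.≤-antisym (d-minimal p) (s≤s⁻¹ (subst (_≤ suc (d u w)) eq (d-snocʳ u e))) , e

  d-intermediate : ∀ u v {m} → m ≤ d u v → ∃ λ w → d u w ≡ m
  d-intermediate u v {m} m≤d = go v (d u v) refl m≤d
    where
    go : ∀ v ℓ → d u v ≡ ℓ → m ≤ ℓ → ∃ λ w → d u w ≡ m
    go v ℓ eq m≤ℓ with ℕ.m≤n⇒m<n∨m≡n m≤ℓ
    ... | inj₂ refl = v , eq
    go v (suc ℓ) eq m≤ℓ | inj₁ (s≤s m≤ℓ′) with d-predecessor u v eq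
    ... | w , eq′ , _ = go w ℓ eq′ m≤ℓ′

  -- The distance from `r` is the position on the path. The values have no gaps, so they fill an
  -- initial segment. Distances of neighbours differ by at most one, and by injectivity not by zero.
  -- Conversely, a vertex at distance m + 1 has a neighbour at distance m, and only one vertex lies
  -- there.
  injectiveDistance⇒path : ∀ r → (∀ {x y} → d r x ≡ d r y → x ≡ y) → IsPathGraph (graph G)
  injectiveDistance⇒path r inj = n , record
    { bijection = mk↔ₛ′ to′ from′
        (λ i → Fin.toℕ-injective (trans (toℕ-to′ (from′ i)) (d-from′ i)))
        (λ v → inj (trans (d-from′ (to′ v)) (toℕ-to′ v)))
    ; preserves = λ u v → mk⇔ (adjacent⇒ u v) (⇒adjacent u v)
    }
    where
    Unattained : ℕ → Set
    Unattained m = ¬ ∃ λ v → d r v ≡ m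

    attained? : ∀ m → Dec (∃ λ v → d r v ≡ m)
    attained? m = anyVertex? λ v → d r v ℕ.≟ m

    leastUnattained : ∃ (IsMinimum Unattained)
    leastUnattained with strictBound (d r ∘ Inverse.from index)
    ... | b , d<b = minimum (¬? ∘ attained?) b λ (v , eq) →
      ℕ.<⇒≢ (d<b (Inverse.to index v))
        (trans (cong (d r) (Inverse.strictlyInverseʳ index v)) eq)

    n : ℕ
    n = proj₁ leastUnattained

    open IsMinimum (proj₂ leastUnattained)

    -- A vertex at distance `n` or more would, by `d-intermediate`, force one at distance exactly
    -- `n`, which is unattained.
    d<n : ∀ v → d r v < n
    d<n v = ℕ.≰⇒> (attained ∘ d-intermediate r v)

    vertexAt : (i : Fin n) → ∃ λ v → d r v ≡ toℕ i
    vertexAt i = decidable-stable (attained? (toℕ i))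
      λ none → ℕ.<⇒≱ (Fin.toℕ<n i) (minimal (toℕ i) none)

    to′ : Vertex G → Fin n
    to′ v = fromℕ< (d<n v)

    from′ : Fin n → Vertex G
    from′ = proj₁ ∘ vertexAt

    d-from′ : ∀ i → d r (from′ i) ≡ toℕ i
    d-from′ = proj₂ ∘ vertexAt

    toℕ-to′ : ∀ v → toℕ (to′ v) ≡ d r v
    toℕ-to′ v = Fin.toℕ-fromℕ< (d<n v)

    Consecutive : Vertex G → Vertex G → Set
    Consecutive u v = suc (toℕ (to′ u)) ≡ toℕ (to′ v)

    consecutive⁺ : ∀ {u v} → u ~ v → d r u < d r v → Consecutive u v
    consecutive⁺ {u} {v} e lt = trans (cong suc (toℕ-to′ u))
      (trans (ℕ.≤-antisym lt (d-snocʳ r e)) (sym (toℕ-to′ v)))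

    consecutive⁻ : ∀ {u v} → Consecutive u v → u ~ v
    consecutive⁻ {u} {v} eq =
      let w , eq′ , e = d-predecessor r v
            (trans (sym (toℕ-to′ v)) (trans (sym eq) (cong suc (toℕ-to′ u))))
      in subst (_~ v) (inj eq′) e

    adjacent⇒ : ∀ u v → u ~ v → Graph._~_ (pathGraph n) (to′ u) (to′ v)
    adjacent⇒ u v e with ℕ.<-cmp (d r u) (d r v)
    ... | tri< lt _ _ = inj₁ (consecutive⁺ e lt)
    ... | tri≈ _ eq _ = contradiction (subst (_~ v) (inj eq) e) ~-irrefl
    ... | tri> _ _ gt = inj₂ (consecutive⁺ (~-sym e) gt)

    ⇒adjacent : ∀ u v → Graph._~_ (pathGraph n) (to′ u) (to′ v) → u ~ v
    ⇒adjacent u v (inj₁ eq) = consecutive⁻ eq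
    ⇒adjacent u v (inj₂ eq) = ~-sym (consecutive⁻ eq)

  -- If `R` had no element besides `g`, every pair would have to be separated by `g`, so the
  -- distance from `g` would be injective and the graph a path.
  resolving-nontrivial : ¬ IsPathGraph (graph G) → ∀ {R} → Resolving R →
                         ∀ g → ∃ λ r → _∈_ G r R × r ≢ g
  resolving-nontrivial notPath {R} res g = decidable-stable
    (anyVertex? λ r → (r ∈? R) ×-dec ¬? (r ≟ g))
    λ none → notPath (injectiveDistance⇒path g λ {x} {y} eq →
      decidable-stable (x ≟ y) λ x≢y →
        let r , r∈R , dr≢ = res x y x≢y in
        none (r , r∈R , λ { refl → dr≢ eq }))

  dim-minimal : ∀ {R} → Resolving R → dim G ≤ ∣ R ∣
  dim-minimal {R} res = IsMinimum.minimal (proj₂ minimumResolving) ∣ R ∣ (R , res , refl)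

  dim-attained : ∃ (MetricBasis G)
  dim-attained = IsMinimum.attained (proj₂ minimumResolving)

-- Distances in the join.

module JoinProperties {k : ℕ} (G : Fin k → ConnectedGraph) (g : ∀ i → Vertex (G i)) where
  open Join G g using (JoinVertex; JoinAdj; within; between; lift; join)

  private
    module G (i : Fin k) where
      open ConnectedGraph (G i) public
      open Distance (G i) public
    W : ConnectedGraph
    W = joinAt G g
    module W where
      open ConnectedGraph W public
      open Distance W public

  -- The expected distance, given by a formula without walks, so that it can be shown to be a lower
  -- bound by induction on an arbitrary walk.
  joinDistance : JoinVertex → JoinVertex → ℕ
  joinDistance (i , x) (j , y) with i Fin.≟ j
  ... | yes refl = G.d i x y
  ... | no _     = G.d i x (g i) + suc (G.d j (g j) y)

  -- An edge reduces the remaining distance to the target by at most one. As the formula vanishes at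
  -- the target, no walk is shorter than its value.
  joinDistance-step : ∀ {u v} w → JoinAdj u v → joinDistance u w ≤ suc (joinDistance v w)
  joinDistance-step (j , y) (within {i} e) with i Fin.≟ j
  ... | yes refl = G.d-consˡ i y e
  ... | no _     = ℕ.+-monoˡ-≤ _ (G.d-consˡ i (g i) e)
  joinDistance-step (j , y) (between {i} {i′} i≢i′) with i Fin.≟ j | i′ Fin.≟ j
  ... | yes refl | yes refl = contradiction refl i≢i′
  -- The clique edge leaves the part of the target, enters it, or runs between two other parts; only
  -- entering brings the target closer.
  ... | yes refl | no _     = ℕ.m≤n⇒m≤1+n (ℕ.≤-trans (ℕ.n≤1+n _) (ℕ.m≤n+m _ _))
  ... | no _     | yes refl = ℕ.≤-reflexive (cong (_+ _) (G.d-self i (g i)))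
  ... | no _     | no _     rewrite G.d-self i (g i) = ℕ.m≤n⇒m≤1+n (ℕ.m≤n+m _ _)

  joinDistance-self : ∀ u → joinDistance u u ≡ 0
  joinDistance-self (i , x) with i Fin.≟ i
  ... | yes refl = G.d-self i x
  ... | no i≢i   = contradiction refl i≢i

  joinDistance-minimal : ∀ {u v ℓ} → W.Walk u v ℓ → joinDistance u v ≤ ℓ
  joinDistance-minimal {u} W.[]      = ℕ.≤-reflexive (joinDistance-self u)
  joinDistance-minimal {v = v} (e W.∷ p) =
    ℕ.≤-trans (joinDistance-step v e) (s≤s (joinDistance-minimal p))

  -- A lifted shortest walk gives the upper bound, and `joinDistance` excludes shortcuts through
  -- other parts.
  d-within : ∀ i x y → W.d (i , x) (i , y) ≡ G.d i x y
  d-within i x y = ℕ.≤-antisym (W.d-minimal (lift (G.d-walk i x y)))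
    (ℕ.≤-trans (ℕ.≤-reflexive (sym eval)) (joinDistance-minimal (W.d-walk (i , x) (i , y))))
    where
    eval : joinDistance (i , x) (i , y) ≡ G.d i x y
    eval with i Fin.≟ i
    ... | yes refl = refl
    ... | no i≢i   = contradiction refl i≢i

  d-between : ∀ {i j} x y → i ≢ j →
              W.d (i , x) (j , y) ≡ G.d i x (g i) + suc (G.d j (g j) y)
  d-between {i} {j} x y i≢j = ℕ.≤-antisym
    (W.d-minimal (join (lift (G.d-walk i x (g i))) (between i≢j) (lift (G.d-walk j (g j) y))))
    (ℕ.≤-trans (ℕ.≤-reflexive (sym eval)) (joinDistance-minimal (W.d-walk (i , x) (j , y))))
    where
    eval : joinDistance (i , x) (j , y) ≡ G.d i x (g i) + suc (G.d j (g j) y)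
    eval with i Fin.≟ j
    ... | yes i≡j = contradiction i≡j i≢j
    ... | no _    = refl

  -- Traces of a resolving set of the join on the parts.

  trace : W.VertexSet → ∀ i → G.VertexSet i
  trace = fibre G.index

  lookup-trace : ∀ R i x →
    lookup (trace R i) (Inverse.to (G.index i) x) ≡ lookup R (Inverse.to W.index (i , x))
  lookup-trace R i x = trans (lookup∘tabulate _ (Inverse.to (G.index i) x))
    (cong (λ z → lookup R (Inverse.to W.index (i , z))) (Inverse.strictlyInverseʳ (G.index i) x))

  ∈-trace⁺ : ∀ {R i x} → (i , x) W.∈ R → G._∈_ i x (trace R i)
  ∈-trace⁺ {R} {i} {x} ∈R = lookup⇒[]= _ _ (trans (lookup-trace R i x) ([]=⇒lookup ∈R))

  ∈-trace⁻ : ∀ {R i x} → G._∈_ i x (trace R i) → (i , x) W.∈ R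
  ∈-trace⁻ {R} {i} {x} ∈T = lookup⇒[]= _ _ (trans (sym (lookup-trace R i x)) ([]=⇒lookup ∈T))

  -- The candidate for the resolving set of part `i`: the added `g i` stands in for all landmarks of
  -- the other parts.
  traceWith : W.VertexSet → ∀ i → G.VertexSet i
  traceWith R i = insert (Inverse.to (G.index i) (g i)) (trace R i)

  traceWith-∋ : ∀ R i → G._∈_ i (g i) (traceWith R i)
  traceWith-∋ R i = ∈-insert _ (trace R i)

  ∈-traceWith⁻ : ∀ {R i x} → G._∈_ i x (traceWith R i) → x ≢ g i → (i , x) W.∈ R
  ∈-traceWith⁻ {i = i} ∈T x≢g = ∈-trace⁻ (∈-insert⁻ (x≢g ∘ Injection.injective (↔⇒↣ (G.index i))) ∈T)

  traceWith-resolving : ∀ {R} → W.Resolving R → ∀ i → G.Resolving i (traceWith R i)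
  traceWith-resolving {R} res i x y x≢y =
    let (j , r) , r∈R , dr≢ = res (i , x) (i , y) (λ { refl → x≢y refl })
    in project (j Fin.≟ i) r∈R dr≢
    where
    project : ∀ {j r} → Dec (j ≡ i) → (j , r) W.∈ R →
              W.d (j , r) (i , x) ≢ W.d (j , r) (i , y) →
              ∃ λ s → G._∈_ i s (traceWith R i) × G.d i s x ≢ G.d i s y
    project {r = r} (yes refl) r∈R dr≢ = r , ∈-insert⁺ _ (∈-trace⁺ r∈R) , λ eq →
      dr≢ (trans (d-within i r x) (trans eq (sym (d-within i r y))))
    -- A landmark outside part `i` measures both vertices by their distance from `g i` plus the same
    -- constant, so `g i` separates them too.
    project {j} {r} (no j≢i) _ dr≢ = g i , traceWith-∋ R i , λ eq →
      dr≢ (trans (d-between r x j≢i)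
        (trans (cong (λ z → G.d j r (g j) + suc z) eq) (sym (d-between r y j≢i))))

  ∣traceWith∣≤ : ∀ R i → ∣ traceWith R i ∣ ≤ suc ∣ trace R i ∣
  ∣traceWith∣≤ R i = ∣insert∣≤ (Inverse.to (G.index i) (g i)) (trace R i)

  dim≤suc-trace : ∀ {R} → W.Resolving R → ∀ i → G.dim i ≤ suc ∣ trace R i ∣
  dim≤suc-trace {R} res i =
    ℕ.≤-trans (G.dim-minimal i (traceWith-resolving res i)) (∣traceWith∣≤ R i)

  sum-suc-trace : ∀ R → sumFin (λ i → suc ∣ trace R i ∣) ≡ ∣ R ∣ + k
  sum-suc-trace R = trans (sumFin-suc λ i → ∣ trace R i ∣) (cong (_+ k) (sym (∣fibre∣ G.index R)))

  -- The lower bound for `dim W`, with `k` added on the right to avoid truncated subtraction.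
  Σdim≤ : ∀ {R} → W.Resolving R → sumFin G.dim ≤ ∣ R ∣ + k
  Σdim≤ {R} res = subst (sumFin G.dim ≤_) (sum-suc-trace R) (sumFin-mono (dim≤suc-trace res))

  -- Unions of resolving sets without the clique vertices.

  Union : (∀ i → G.VertexSet i) → JoinVertex → Set
  Union Rs (i , x) = G._∈_ i x (Rs i) × x ≢ g i

  module _ (2≤k : 2 ≤ k) (notPath : ∀ i → ¬ IsPathGraph (graph (G i))) where

    -- One inclusion is enough, since enlarging a resolving set keeps it resolving.
    union-resolving : ∀ {R Rs} → (∀ i → G.Resolving i (Rs i)) →
                      (∀ {v} → Union Rs v → v W.∈ R) → W.Resolving R
    union-resolving {R} {Rs} res Rs⊆R = resolves
      where
      landmark : ∀ i → ∃ λ r → (i , r) W.∈ R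
      landmark i =
        let r , r∈ , r≢g = G.resolving-nontrivial i (notPath i) (res i) (g i)
        in r , Rs⊆R (r∈ , r≢g)

      Separated : JoinVertex → JoinVertex → Set
      Separated u v = ∃ λ r → r W.∈ R × W.d r u ≢ W.d r v

      sameSide : ∀ i x y → x ≢ y → Separated (i , x) (i , y)
      sameSide i x y x≢y = let r , r∈ , dr≢ = res i x y x≢y in separate (G._≟_ i r (g i)) r∈ dr≢
        where
        separate : ∀ {r} → Dec (r ≡ g i) → G._∈_ i r (Rs i) → G.d i r x ≢ G.d i r y →
                   Separated (i , x) (i , y)
        separate {r} (no r≢g) r∈ dr≢ = (i , r) , Rs⊆R (r∈ , r≢g) , λ eq →
          dr≢ (trans (sym (d-within i r x)) (trans eq (d-within i r y)))
        separate (yes refl) _ dr≢ =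
          -- The separating landmark is the deleted `g i`. As there are at least two parts, some
          -- other part has a landmark, and it sees part `i` through `g i`.
          let j , i≢j = other 2≤k i
              s , s∈R = landmark j
          in (j , s) , s∈R , λ eq →
            dr≢ (ℕ.suc-injective (ℕ.+-cancelˡ-≡ (G.d j s (g j)) _ _
              (trans (sym (d-between s x (i≢j ∘ sym))) (trans eq (d-between s y (i≢j ∘ sym))))))

      -- The equality says d(r,x) = d(r,g i) + 1 + d(g j,y), while d(r,x) ≤ d(r,g i) + d(g i,x) by
      -- the triangle inequality; cancel d(r,g i).
      closer : ∀ {i j} x y r → i ≢ j → W.d (i , r) (i , x) ≡ W.d (i , r) (j , y) →
               G.d j (g j) y < G.d i (g i) x
      closer {i} {j} x y r i≢j eq = ℕ.+-cancelˡ-≤ (G.d i r (g i)) _ _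
        (ℕ.≤-trans (ℕ.≤-reflexive
            (trans (sym (d-between r y i≢j)) (trans (sym eq) (d-within i r x))))
          (G.d-triangle i r (g i) x))

      otherSide : ∀ {i j} x y → i ≢ j → Separated (i , x) (j , y)
      otherSide {i} {j} x y i≢j =
        let r , r∈R = landmark i
            s , s∈R = landmark j
        in separate r∈R s∈R (W.d (i , r) (i , x) ℕ.≟ W.d (i , r) (j , y))
        where
        separate : ∀ {r s} → (i , r) W.∈ R → (j , s) W.∈ R →
                   Dec (W.d (i , r) (i , x) ≡ W.d (i , r) (j , y)) → Separated (i , x) (j , y)
        separate {r} r∈R s∈R (no dr≢) = (i , r) , r∈R , dr≢
        separate {r} {s} r∈R s∈R (yes eq) = (j , s) , s∈R , λ eq′ →
          ℕ.<-asym (closer x y r i≢j eq) (closer y x s (i≢j ∘ sym) (sym eq′))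

      resolves : W.Resolving R
      resolves (i , x) (j , y) u≢v = byParts (i Fin.≟ j) x y u≢v
        where
        byParts : ∀ {i j} → Dec (i ≡ j) → ∀ x y → (i , x) ≢ (j , y) → Separated (i , x) (j , y)
        byParts (yes refl) x y u≢v = sameSide _ x y λ { refl → u≢v refl }
        byParts (no i≢j)   x y _   = otherSide x y i≢j

    -- Putting `g i` back into the trace of `R` recovers `Rs i` exactly, and `g i` was absent, so
    -- each trace has one element fewer than a metric basis.
    union-size : ∀ {R Rs} → (∀ i → MetricBasis (G i) (Rs i) × G._∈_ i (g i) (Rs i)) →
                 (λ v → v W.∈ R) ≐ Union Rs → ∣ R ∣ + k ≡ sumFin G.dim
    union-size {R} {Rs} bases (R⊆ , ⊆R) = trans (sym (sum-suc-trace R)) (sumFin-cong size)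
      where
      g∉trace : ∀ i → ¬ G._∈_ i (g i) (trace R i)
      g∉trace i g∈ = proj₂ (R⊆ (∈-trace⁻ g∈)) refl

      ⊆Rs : ∀ i {x} → G._∈_ i x (traceWith R i) → G._∈_ i x (Rs i)
      ⊆Rs i {x} x∈ with G._≟_ i x (g i)
      ... | yes refl = proj₂ (bases i)
      ... | no x≢g   = proj₁ (R⊆ (∈-traceWith⁻ x∈ x≢g))

      Rs⊆ : ∀ i {x} → G._∈_ i x (Rs i) → G._∈_ i x (traceWith R i)
      Rs⊆ i {x} x∈ with G._≟_ i x (g i)
      ... | yes refl = traceWith-∋ R i
      ... | no x≢g   = ∈-insert⁺ _ (∈-trace⁺ (⊆R (x∈ , x≢g)))

      -- Passes from inclusion over vertices to inclusion over indices: every index is the index of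
      -- some vertex.
      extensional : ∀ i {S T} → (∀ {x} → G._∈_ i x S → G._∈_ i x T) → ∀ {j} → j ∈ꜰ S → j ∈ꜰ T
      extensional i {S} {T} S⊆T {j} j∈S = subst (_∈ꜰ T) (Inverse.strictlyInverseˡ (G.index i) j)
        (S⊆T (subst (_∈ꜰ S) (sym (Inverse.strictlyInverseˡ (G.index i) j)) j∈S))

      size : ∀ i → suc ∣ trace R i ∣ ≡ G.dim i
      size i = trans (sym (∣insert∣-∉ (g∉trace i)))
        (trans (cong ∣_∣ (⊆-antisym (extensional i (⊆Rs i)) (extensional i (Rs⊆ i))))
          (proj₂ (proj₁ (bases i))))

    -- Dimension and metric bases of the join.

    module _ (inBasis : ∀ i → ∃ λ R → MetricBasis (G i) R × G._∈_ i (g i) R) where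

      dim-join : W.dim + k ≡ sumFin G.dim
      dim-join = ℕ.≤-antisym upper lower
        where
        Rs : ∀ i → G.VertexSet i
        Rs i = proj₁ (inBasis i)

        upper : W.dim + k ≤ sumFin G.dim
        -- The given bases, with the `g i` removed, form a resolving set of the right size.
        upper with comprehension W.graph {Union Rs}
                     (λ (i , x) → G._∈?_ i x (Rs i) ×-dec ¬? (G._≟_ i x (g i)))
        ... | R , R⇔ = subst (W.dim + k ≤_)
          (union-size (λ i → proj₂ (inBasis i))
            ((λ {v} → Equivalence.to (R⇔ v)) , λ {v} → Equivalence.from (R⇔ v)))
          (ℕ.+-monoˡ-≤ k (W.dim-minimal
            (union-resolving (λ i → proj₁ (proj₁ (proj₂ (inBasis i))))
              λ {v} → Equivalence.from (R⇔ v))))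

        lower : sumFin G.dim ≤ W.dim + k
        lower with W.dim-attained
        ... | R , res , size = subst (λ m → sumFin G.dim ≤ m + k) size (Σdim≤ res)

      -- The bounds `dim≤suc-trace` add up to an equality by `dim-join`, so each of them is an
      -- equality and every `traceWith R i` has minimum size.
      basis⇒union : ∀ R → W.MetricBasis R → ∃ λ Rs →
        (∀ i → MetricBasis (G i) (Rs i) × G._∈_ i (g i) (Rs i)) × (λ v → v W.∈ R) ≐ Union Rs
      basis⇒union R (res , size) = traceWith R ,
        (λ i → (traceWith-resolving res i ,
                ℕ.≤-antisym (ℕ.≤-trans (∣traceWith∣≤ R i) (tight i))
                            (G.dim-minimal i (traceWith-resolving res i))) ,
               traceWith-∋ R i) ,
        (λ {v} v∈R → ∈-insert⁺ _ (∈-trace⁺ v∈R) , λ { refl → g∉trace _ (∈-trace⁺ v∈R) }) ,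
        λ (x∈ , x≢g) → ∈-traceWith⁻ x∈ x≢g
        where
        tight : ∀ i → suc ∣ trace R i ∣ ≤ G.dim i
        tight = sumFin-tight (dim≤suc-trace res) (ℕ.≤-reflexive
          (trans (sum-suc-trace R) (trans (cong (_+ k) size) dim-join)))

        g∉trace : ∀ i → ¬ G._∈_ i (g i) (trace R i)
        -- If `g i` were in the trace, inserting it would change nothing, and the trace alone would
        -- resolve `G i` with fewer than dim(G i) elements.
        g∉trace i g∈ = ℕ.<⇒≱ (tight i) (subst (λ S → G.dim i ≤ ∣ S ∣) (insert-∈ g∈)
          (G.dim-minimal i (traceWith-resolving res i)))

      union⇒basis : ∀ R → (∃ λ Rs →
        (∀ i → MetricBasis (G i) (Rs i) × G._∈_ i (g i) (Rs i)) × (λ v → v W.∈ R) ≐ Union Rs) →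
        W.MetricBasis R
      union⇒basis R (Rs , bases , R≐) =
        union-resolving (λ i → proj₁ (proj₁ (bases i))) (proj₂ R≐) ,
        ℕ.+-cancelʳ-≡ k _ _ (trans (union-size bases R≐) (sym dim-join))

theorem5 : (k : ℕ) → 2 ≤ k →
    (G : Fin k → ConnectedGraph) →
    (∀ i → ¬ IsPathGraph (graph (G i))) →
    (g : ∀ i → Vertex (G i)) →
    (∀ i → ∃ λ R → MetricBasis (G i) R × _∈_ (G i) (g i) R) →
    let W = joinAt G g in
    ((R : VertexSet W) →
    MetricBasis W R ⇔
    (∃ λ (Rs : ∀ i → VertexSet (G i)) →
    (∀ i → MetricBasis (G i) (Rs i) × _∈_ (G i) (g i) (Rs i)) ×
    ((λ v → _∈_ W v R) ≐ (λ (i , x) → _∈_ (G i) x (Rs i) × x ≢ g i))))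
    × + dim W ≡ + sumFin (λ i → dim (G i)) - + k
theorem5 k 2≤k G notPath g inBasis =
  (λ R → mk⇔ (basis⇒union 2≤k notPath inBasis R) (union⇒basis 2≤k notPath inBasis R)) ,
  (begin
    -- Adding and removing `k` reduces the integer identity to `dim-join`; the truncated subtraction
    -- is exact because k ≤ dim W + k.
    + dim W                            ≡⟨ cong +_ (ℕ.m+n∸n≡m (dim W) k) ⟨
    + (dim W + k ∸ k)                  ≡⟨ ℤ.⊖-≥ (ℕ.m≤n+m k (dim W)) ⟨
    (dim W + k) ⊖ k                    ≡⟨ ℤ.m-n≡m⊖n (dim W + k) k ⟨
    + (dim W + k) - + k                ≡⟨ cong (λ s → + s - + k) (dim-join 2≤k notPath inBasis) ⟩
    + sumFin (λ i → dim (G i)) - + k   ∎)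
  where
  open JoinProperties G g
  W = joinAt G g
  open ≡-Reasoning
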